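{- Let $\mathbf{P}=\{p_n(x)\}_{n\ge0}$ be the Sheffer sequence for the pair $(1,f(t))$, where $f$ is odd, i.e. $f(-t)=-f(t)$. Then for $n\ge1$ and $0\le k\le n-1$, $$A_{n,k}(\mathbf{P})=A_{n,n-1-k}(\mathbf{P}).$$
   Context: $f$ is a formal power series over $\mathbb{C}$ with $f(0)=0$, $f'(0)\ne0$, and $\bar f$ its compositional inverse; $\{p_n\}$ is Sheffer for $(1,f)$ iff $\sum_{n\ge0}p_n(x)\frac{t^n}{n!}=e^{x\bar f(t)}$. The Eulerian numbers $A_{n,k}(\mathbf{P})$ ($0\le k\le n$) are the unique coefficients with $p_n(x)=\sum_{k=0}^{n}A_{n,k}(\mathbf{P})\binom{x+n-k-1}{n}$, where $\binom{y}{n}=y(y-1)\cdots(y-n+1)/n!$. -}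

module Defs where

open import Algebra.Apartness.Bundles using (HeytingField; HeytingCommutativeRing)
open import Algebra.Bundles using (CommutativeRing)
open import Algebra.Bundles.Raw using (RawRing)
import Algebra.Definitions.RawSemiring as RawSemiringDefs
open import Data.Fin.Base using (toℕ)
open import Data.List.Base using (List; []; _∷_; map)
open import Data.Nat.Base as ℕ using (ℕ; zero; suc; _∸_)
open import Data.Product.Base using (proj₁)
open import Level using (Level; _⊔_)

private
  variable
    c ℓ ℓ₁ ℓ₂ : Level

-- R[x]: lists of coefficients in ascending degree, identified when all their
-- coefficients agree (so trailing zeros do not matter).
module Polynomials (R : RawRing c ℓ) where
  open RawRing R

  Poly : Set c
  Poly = List Carrier

  coeff : Poly → ℕ → Carrier
  coeff []      _       = 0#
  coeff (a ∷ p) zero    = a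
  coeff (a ∷ p) (suc i) = coeff p i

  addPoly : Poly → Poly → Poly
  addPoly []      q       = q
  addPoly (a ∷ p) []      = a ∷ p
  addPoly (a ∷ p) (b ∷ q) = (a + b) ∷ addPoly p q

  mulPoly : Poly → Poly → Poly
  mulPoly []      q = []
  mulPoly (a ∷ p) q = addPoly (map (a *_) q) (0# ∷ mulPoly p q)

  polynomialRing : RawRing c ℓ
  polynomialRing = record
    { Carrier = Poly
    ; _≈_     = λ p q → ∀ i → coeff p i ≈ coeff q i
    ; _+_     = addPoly
    ; _*_     = mulPoly
    ; -_      = map (-_)
    ; 0#      = []
    ; 1#      = 1# ∷ []
    }

  const : Carrier → Poly
  const a = a ∷ []

  X : Poly
  X = 0# ∷ 1# ∷ []

-- R[[t]]: a series is its sequence of coefficients.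
module FormalPowerSeries (R : RawRing c ℓ) where
  open RawRing R
  open RawSemiringDefs rawSemiring using (sum)

  Series : Set c
  Series = ℕ → Carrier

  constSeries : Carrier → Series
  constSeries a zero    = a
  constSeries a (suc _) = 0#

  powerSeriesRing : RawRing c ℓ
  powerSeriesRing = record
    { Carrier = Series
    ; _≈_     = λ f g → ∀ n → f n ≈ g n
    ; _+_     = λ f g n → f n + g n
    ; _*_     = λ f g n → sum {suc n} (λ i → f (toℕ i) * g (n ∸ toℕ i))
    ; -_      = λ f n → - f n
    ; 0#      = constSeries 0#
    ; 1#      = constSeries 1#
    }

  open RawSemiringDefs (RawRing.rawSemiring powerSeriesRing) using (_^_)

  t : Series
  t zero          = 0#
  t (suc zero)    = 1#
  t (suc (suc _)) = 0#

  -- The composite f(g(t)) = Σₖ fₖ g(t)ᵏ, for g(0) = 0 only: then g(t)ᵏ has no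
  -- terms of degree below k, so k ≤ n suffices for the coefficient of tⁿ.
  infixr 9 _⊚_
  _⊚_ : Series → Series → Series
  (f ⊚ g) n = sum {suc n} (λ k → f (toℕ k) * (g ^ toℕ k) n)

CharacteristicZero : HeytingField c ℓ₁ ℓ₂ → Set ℓ₂
CharacteristicZero K = ∀ n → (suc n × 1#) # 0#
  where
  open HeytingField K
  open CommutativeRing (HeytingCommutativeRing.commutativeRing heytingCommutativeRing)
    using (rawRing)
  open RawSemiringDefs (RawRing.rawSemiring rawRing) using (_×_)

-- The library has no ℂ. The coefficients are taken in an arbitrary (Heyting)
-- field of characteristic zero, of which ℂ is an instance; the apartness
-- x # y is the constructive reading of x ≠ y.
module Umbral (K : HeytingField c ℓ₁ ℓ₂) (char0 : CharacteristicZero K) where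

  open HeytingField K

  fieldRing : RawRing c ℓ₁
  fieldRing = CommutativeRing.rawRing
    (HeytingCommutativeRing.commutativeRing heytingCommutativeRing)

  open Polynomials fieldRing public
  open FormalPowerSeries fieldRing public

  -- 1 / n!; char0 makes suc n - 0 invertible.
  1/_! : ℕ → Carrier
  1/ zero  ! = 1#
  1/ suc n ! = proj₁ (#⇒invertible (char0 n)) * 1/ n !

  module K[x]      = RawRing polynomialRing
  module K[[t]]    = RawRing powerSeriesRing
  module K[x][t]   = FormalPowerSeries polynomialRing
  module K[x][[t]] = RawRing K[x][t].powerSeriesRing

  record IsDelta (f : Series) : Set (ℓ₁ ⊔ ℓ₂) where
    field
      f[0]≈0  : f 0 ≈ 0#
      f′[0]#0 : f 1 # 0#

  Odd : Series → Set ℓ₁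
  Odd f = (f ⊚ (K[[t]].- t)) K[[t]].≈ (K[[t]].- f)

  record IsCompositionalInverse (f f̄ : Series) : Set ℓ₁ where
    field
      f̄[0]≈0 : f̄ 0 ≈ 0#
      f∘f̄≈t  : (f ⊚ f̄) K[[t]].≈ t
      f̄∘f≈t  : (f̄ ⊚ f) K[[t]].≈ t

  exp : K[x][t].Series
  exp n = const (1/ n !)

  x·_ : Series → K[x][t].Series
  (x· g) n = X K[x].* const (g n)

  -- f̄ is unique, so its existential packaging involves no choice.
  record IsSheffer[1,_] (f : Series) (p : ℕ → Poly) : Set (c ⊔ ℓ₁) where
    field
      f̄            : Series
      f̄-inverse    : IsCompositionalInverse f f̄
      Σpₙtⁿ/n!≈eˣᶠ̄ : (λ n → p n K[x].* const (1/ n !)) K[x][[t]].≈ (exp K[x][t].⊚ (x· f̄))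

  open RawSemiringDefs K[x].rawSemiring using (_×_; sum; product)

  infixl 6 _-ₓ_
  _-ₓ_ : Poly → Poly → Poly
  p -ₓ q = p K[x].+ (K[x].- q)

  binomial : Poly → ℕ → Poly
  binomial y n = product {n} (λ i → y -ₓ toℕ i × K[x].1#) K[x].* const (1/ n !)

  -- Only the values A n k with k ≤ n matter. The subtraction in x + n - k - 1
  -- is that of K[x], so k = n gives x - 1.
  IsEulerian : (ℕ → Poly) → (ℕ → ℕ → Carrier) → Set ℓ₁
  IsEulerian p A = ∀ n → p n K[x].≈ sum {suc n} λ k →
    const (A n (toℕ k)) K[x].*
      binomial (X K[x].+ n × K[x].1# -ₓ toℕ k × K[x].1# -ₓ K[x].1#) n

{-# OPTIONS --safe #-}

-- An odd f has an odd inverse f̄, so comparing coefficients in e^{x f̄(t)} gives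
-- pₙ(-x) = (-1)ⁿ pₙ(x), and pₙ(0) = 0 for n ≥ 1. The reflection
-- C(n-1-y, n) = (-1)ⁿ C(y, n) turns the Eulerian expansion of pₙ(-x) into
-- Σₖ Aₙₖ C(x+k, n) = Σₖ Aₙₖ C(x+n-k-1, n). At x = 0 this gives Aₙₙ = pₙ(0) = 0,
-- and the linear independence of the C(x+n-k-1, n), k < n, gives the symmetry.
--
-- Parity of a series F is used in the form (-1)ⁿ Fₙ = -Fₙ, which avoids deciding
-- whether n is even. Polynomial identities are used through evaluation.
module Submission where

open import Defs
open import Algebra.Apartness.Bundles using (HeytingField; HeytingCommutativeRing)
open import Algebra.Bundles using (CommutativeRing; Monoid; RawMonoid; RawRing)
import Algebra.Definitions.RawMonoid as RawMonoidDefs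
import Algebra.Definitions.RawSemiring as RawSemiringDefs
open import Algebra.Morphism.Structures using (IsMonoidHomomorphism; IsRingHomomorphism)
import Algebra.Properties.CommutativeSemiring.Exp as Exp
import Algebra.Properties.Monoid.Sum as MonoidSum
import Algebra.Properties.Ring as RingProperties
import Algebra.Properties.Semiring.Mult as SemiringMult
import Algebra.Properties.Semiring.Sum as SemiringSum
import Algebra.Solver.Ring.NaturalCoefficients.Default as SemiringSolver
open import Data.Fin.Base using (Fin; zero; suc; toℕ; fromℕ; fromℕ<; punchIn)
open import Data.Fin.Permutation using (reverse)
import Data.Fin.Properties as Fin
open import Data.List.Base using ([]; _∷_; map)
open import Data.Nat.Base as ℕ using (ℕ; zero; suc; _≤_; _<_; z≤n; s≤s; s<s; _∸_)
open import Data.Nat.Induction using (<-rec)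
import Data.Nat.Properties as ℕ
open import Data.Product.Base using (proj₁; proj₂)
open import Function.Base using (_∘_)
open import Level using (Level)
open import Relation.Binary.Definitions using (tri<; tri≈; tri>)
open import Relation.Binary.PropositionalEquality.Core as ≡ using (_≡_; _≢_)
import Relation.Binary.Reasoning.Setoid as SetoidReasoning
open import Relation.Nullary.Negation using (contradiction)

private
  variable
    a b c ℓ ℓ₁ ℓ₂ : Level

-- Monoid homomorphisms and iterated operations.

module MonoidHomomorphism
  {M : RawMonoid a ℓ₁} (N : Monoid b ℓ₂) {φ : RawMonoid.Carrier M → Monoid.Carrier N}
  (φ-hom : IsMonoidHomomorphism M (Monoid.rawMonoid N) φ) where

  private
    module M = RawMonoidDefs M
    module N = RawMonoidDefs (Monoid.rawMonoid N)
  open Monoid N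
  open IsMonoidHomomorphism φ-hom

  -- The source is a raw monoid because no laws are proved for `polynomialRing`. Taken additively or
  -- multiplicatively, the same recursion serves sums and products.
  sum-homo : ∀ {n} (f : Fin n → RawMonoid.Carrier M) → φ (M.sum f) ≈ N.sum (φ ∘ f)
  sum-homo {zero}  f = ε-homo
  sum-homo {suc n} f = trans (homo _ _) (∙-congˡ (sum-homo (f ∘ suc)))

  ×-homo : ∀ n x → φ (n M.× x) ≈ n N.× φ x
  ×-homo zero    x = ε-homo
  ×-homo (suc n) x = trans (homo _ _) (∙-congˡ (×-homo n x))

-- Finite sums with few nonzero terms.

module RingSums (R : CommutativeRing c ℓ) where
  open CommutativeRing R hiding (zero)
  open SemiringSum semiring

  sum-zero : ∀ {n} (f : Fin n → Carrier) → (∀ i → f i ≈ 0#) → sum f ≈ 0#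
  sum-zero {n} f f≈0 = trans (sum-cong-≋ f≈0) (sum-replicate-zero n)

  sum-single : ∀ {n} (f : Fin n → Carrier) i → (∀ j → j ≢ i → f j ≈ 0#) → sum f ≈ f i
  sum-single {suc n} f i f≈0 = trans (sum-remove {i = i} f) (trans
    (+-congˡ (sum-zero (f ∘ punchIn i) λ j → f≈0 (punchIn i j) (Fin.punchInᵢ≢i i j)))
    (+-identityʳ (f i)))

  -- Isolates the diagonal term of a triangular system. The summand lives on `ℕ`, so the result
  -- mentions `n` itself and not `toℕ (fromℕ n)`.
  sum-last : ∀ {n} (f : ℕ → Carrier) → (∀ {k} → k < n → f k ≈ 0#) →
             sum {suc n} (f ∘ toℕ) ≈ f n
  sum-last {n} f f≈0 = trans
    (sum-single (f ∘ toℕ) (fromℕ n) λ j j≢n → f≈0 (ℕ.≤∧≢⇒< (Fin.toℕ≤pred[n] j)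
      λ j≡n → j≢n (Fin.toℕ-injective (≡.trans j≡n (≡.sym (Fin.toℕ-fromℕ n))))))
    (reflexive (≡.cong f (Fin.toℕ-fromℕ n)))

  sum-snoc : ∀ n (f : ℕ → Carrier) → sum {suc n} (f ∘ toℕ) ≈ sum {n} (f ∘ toℕ) + f n
  sum-snoc n f = trans (sum-init-last {n} (f ∘ toℕ)) (+-cong
    (sum-cong-≋ {n} λ i → reflexive (≡.cong f (Fin.toℕ-inject₁ i)))
    (reflexive (≡.cong f (Fin.toℕ-fromℕ n))))

-- Evaluation of polynomials as a ring homomorphism.

module Evaluation (R : CommutativeRing c ℓ) where
  open CommutativeRing R hiding (zero)
  open Polynomials rawRing
  open SetoidReasoning setoid
  open SemiringSolver commutativeSemiring using (solve; _:+_; _:*_; _:=_)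
  open RingProperties ring using (-0#≈0#; -‿+-comm; -‿distribʳ-*)

  eval : Carrier → Poly → Carrier
  eval a []      = 0#
  eval a (b ∷ p) = b + a * eval a p

  eval-congˡ : ∀ p {a b} → a ≈ b → eval a p ≈ eval b p
  eval-congˡ []      a≈b = refl
  eval-congˡ (d ∷ p) a≈b = +-congˡ (*-cong a≈b (eval-congˡ p a≈b))

  module _ (a : Carrier) where

    -- Handles trailing zeros: equal polynomials may be lists of different lengths, and `eval-cong`
    -- meets this case when one list ends first.
    eval-zero : ∀ p → (∀ i → coeff p i ≈ 0#) → eval a p ≈ 0#
    eval-zero []      p≈0 = refl
    eval-zero (b ∷ p) p≈0 = begin
      b + a * eval a p ≈⟨ +-cong (p≈0 0) (*-congˡ (eval-zero p (p≈0 ∘ suc))) ⟩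
      0# + a * 0#      ≈⟨ trans (+-identityˡ _) (zeroʳ a) ⟩
      0#               ∎

    eval-cong : ∀ p q → (∀ i → coeff p i ≈ coeff q i) → eval a p ≈ eval a q
    eval-cong []      q       p≈q = sym (eval-zero q (sym ∘ p≈q))
    eval-cong (b ∷ p) []      p≈q = eval-zero (b ∷ p) p≈q
    eval-cong (b ∷ p) (d ∷ q) p≈q = +-cong (p≈q 0) (*-congˡ (eval-cong p q (p≈q ∘ suc)))

    eval-addPoly : ∀ p q → eval a (addPoly p q) ≈ eval a p + eval a q
    eval-addPoly []      q       = sym (+-identityˡ _)
    eval-addPoly (b ∷ p) []      = sym (+-identityʳ _)
    eval-addPoly (b ∷ p) (d ∷ q) = trans
      (+-congˡ (*-congˡ (eval-addPoly p q)))
      (solve 5 (λ a b d x y → b :+ d :+ a :* (x :+ y) := b :+ a :* x :+ (d :+ a :* y))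
        refl a b d (eval a p) (eval a q))

    eval-scale : ∀ b p → eval a (map (b *_) p) ≈ b * eval a p
    eval-scale b []      = sym (zeroʳ b)
    eval-scale b (d ∷ p) = trans
      (+-congˡ (*-congˡ (eval-scale b p)))
      (solve 4 (λ a b d x → b :* d :+ a :* (b :* x) := b :* (d :+ a :* x)) refl a b d (eval a p))

    eval-mulPoly : ∀ p q → eval a (mulPoly p q) ≈ eval a p * eval a q
    eval-mulPoly []      q = sym (zeroˡ _)
    eval-mulPoly (b ∷ p) q = begin
      eval a (addPoly (map (b *_) q) (0# ∷ mulPoly p q))
        ≈⟨ eval-addPoly (map (b *_) q) _ ⟩
      eval a (map (b *_) q) + (0# + a * eval a (mulPoly p q))
        ≈⟨ +-cong (eval-scale b q) (trans (+-identityˡ _) (*-congˡ (eval-mulPoly p q))) ⟩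
      b * eval a q + a * (eval a p * eval a q)
        ≈⟨ solve 4 (λ a b x y → b :* y :+ a :* (x :* y) := (b :+ a :* x) :* y) refl
             a b (eval a p) (eval a q) ⟩
      (b + a * eval a p) * eval a q ∎

    eval-neg : ∀ p → eval a (map (-_) p) ≈ - eval a p
    eval-neg []      = sym -0#≈0#
    eval-neg (b ∷ p) = trans
      (+-congˡ (trans (*-congˡ (eval-neg p)) (sym (-‿distribʳ-* _ _))))
      (-‿+-comm b (a * eval a p))

    eval-const : ∀ b → eval a (const b) ≈ b
    eval-const b = trans (+-congˡ (zeroʳ a)) (+-identityʳ b)

    eval-X : eval a X ≈ a
    eval-X = trans (+-identityˡ _) (trans (*-congˡ (eval-const 1#)) (*-identityʳ a))

    eval-isRingHomomorphism : IsRingHomomorphism polynomialRing rawRing (eval a)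
    eval-isRingHomomorphism = record
      { isSemiringHomomorphism = record
        { isNearSemiringHomomorphism = record
          { +-isMonoidHomomorphism = record
            { isMagmaHomomorphism = record
              { isRelHomomorphism = record { cong = λ {p} {q} → eval-cong p q }
              ; homo = eval-addPoly
              }
            ; ε-homo = refl
            }
          ; *-homo = eval-mulPoly
          }
        ; 1#-homo = eval-const 1#
        }
      ; -‿homo = eval-neg
      }

-- Change of coefficient ring in power series.

module SeriesHomomorphism
  {S : RawRing a ℓ₁} (R : CommutativeRing b ℓ₂) {φ : RawRing.Carrier S → CommutativeRing.Carrier R}
  (φ-hom : IsRingHomomorphism S (CommutativeRing.rawRing R) φ) where

  open CommutativeRing R hiding (zero)
  open SemiringSum semiring
  open IsRingHomomorphism φ-hom
  open MonoidHomomorphism +-monoid +-isMonoidHomomorphism using (sum-homo)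
  private
    module S where
      open RawRing S public using (_*_)
      open FormalPowerSeries S public
      open RawSemiringDefs (RawRing.rawSemiring powerSeriesRing) public using (_^_)
    module R where
      open FormalPowerSeries rawRing public
      open RawSemiringDefs (RawRing.rawSemiring powerSeriesRing) public using (_^_)

  -- Used with evaluation: it carries convolution powers over `K[x]` down to series over the field,
  -- where the parity lemmas apply.
  ^-homo : ∀ F k n → φ ((F S.^ k) n) ≈ ((φ ∘ F) R.^ k) n
  ^-homo F zero    zero    = 1#-homo
  ^-homo F zero    (suc n) = 0#-homo
  ^-homo F (suc k) n       = trans
    (sum-homo {suc n} λ i → F (toℕ i) S.* (F S.^ k) (n ∸ toℕ i))
    (sum-cong-≋ {suc n} λ i → trans (*-homo (F (toℕ i)) _) (*-congˡ (^-homo F k (n ∸ toℕ i))))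

-- Powers, composition and oddness of power series.

module SeriesPowers (R : CommutativeRing c ℓ) where
  open CommutativeRing R hiding (zero)
  open SetoidReasoning setoid
  open SemiringSum semiring
  open Exp commutativeSemiring using (_^_; ^-homo-*)
  open SemiringSolver commutativeSemiring using (solve; _:+_; _:*_; _:=_)
  open RingProperties ring using (-1*x≈-x; +-inverseˡ-unique)
  open RingSums R
  open FormalPowerSeries rawRing
  open RawRing powerSeriesRing public using () renaming (_*_ to _⊛_; -_ to ⊝_; _≈_ to _≋_)
  open RawSemiringDefs (RawRing.rawSemiring powerSeriesRing) public using () renaming (_^_ to _⊛^_)

  1^n≈1 : ∀ n → 1# ^ n ≈ 1#
  1^n≈1 zero    = refl
  1^n≈1 (suc n) = trans (*-identityˡ _) (1^n≈1 n)

  ⊛-cong : ∀ {F F′ G G′} → F ≋ F′ → G ≋ G′ → F ⊛ G ≋ F′ ⊛ G′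
  ⊛-cong F≋F′ G≋G′ n = sum-cong-≋ {suc n} λ i → *-cong (F≋F′ (toℕ i)) (G≋G′ (n ∸ toℕ i))

  ⊛^-cong : ∀ {F G} → F ≋ G → ∀ k → F ⊛^ k ≋ G ⊛^ k
  ⊛^-cong F≋G zero    n = refl
  ⊛^-cong F≋G (suc k) n = ⊛-cong F≋G (⊛^-cong F≋G k) n

  scale-⊛^ : ∀ x F k n → ((λ i → x * F i) ⊛^ k) n ≈ x ^ k * (F ⊛^ k) n
  scale-⊛^ x F zero    n = sym (*-identityˡ _)
  scale-⊛^ x F (suc k) n = trans
    (sum-cong-≋ {suc n} λ i → trans
      (*-congˡ (scale-⊛^ x F k (n ∸ toℕ i)))
      (solve 4 (λ x f y g → x :* f :* (y :* g) := x :* y :* (f :* g)) refl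
        x (F (toℕ i)) (x ^ k) ((F ⊛^ k) (n ∸ toℕ i))))
    (sym (*-distribˡ-sum {suc n} (x * x ^ k) λ i → F (toℕ i) * (F ⊛^ k) (n ∸ toℕ i)))

  -- The twist is the substitution of `x t` for `t`. It is multiplicative because each product in
  -- the convolution carries the weights `x ^ i` and `x ^ (n ∸ i)`, which combine to `x ^ n`.
  twist-⊛^ : ∀ x F k n → ((λ i → x ^ i * F i) ⊛^ k) n ≈ x ^ n * (F ⊛^ k) n
  twist-⊛^ x F zero    zero    = sym (*-identityˡ _)
  twist-⊛^ x F zero    (suc n) = sym (zeroʳ _)
  twist-⊛^ x F (suc k) n       = trans
    (sum-cong-≋ {suc n} λ i → trans
      (*-congˡ (twist-⊛^ x F k (n ∸ toℕ i)))
      (trans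
        (solve 4 (λ x f y g → x :* f :* (y :* g) := x :* y :* (f :* g)) refl
          (x ^ toℕ i) (F (toℕ i)) (x ^ (n ∸ toℕ i)) ((F ⊛^ k) (n ∸ toℕ i)))
        (*-congʳ (trans (sym (^-homo-* x (toℕ i) (n ∸ toℕ i)))
          (reflexive (≡.cong (x ^_) (ℕ.m+[n∸m]≡n (Fin.toℕ≤pred[n] i))))))))
    (sym (*-distribˡ-sum {suc n} (x ^ n) λ i → F (toℕ i) * (F ⊛^ k) (n ∸ toℕ i)))

  -- Each factor contributes at least one degree: index `0` is killed by `F 0`, and a later index
  -- leaves a degree below `k` for the remaining `k` factors.
  ⊛^-order : ∀ F → F 0 ≈ 0# → ∀ {k n} → n < k → (F ⊛^ k) n ≈ 0#
  ⊛^-order F F₀≈0 {suc k} {n} n<1+k =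
   sum-zero {suc n} (λ i → F (toℕ i) * (F ⊛^ k) (n ∸ toℕ i)) λ where
    zero    → trans (*-congʳ F₀≈0) (zeroˡ _)
    (suc i) → trans (*-congˡ (⊛^-order F F₀≈0 (ℕ.<-≤-trans
      (ℕ.∸-monoʳ-< (ℕ.z<s) (Fin.toℕ≤pred[n] (suc i))) (ℕ.≤-pred n<1+k)))) (zeroʳ _)

  ⊛^-leading : ∀ F → F 0 ≈ 0# → ∀ n → (F ⊛^ n) n ≈ F 1 ^ n
  ⊛^-leading F F₀≈0 zero    = refl
  ⊛^-leading F F₀≈0 (suc n) = trans
    (sum-single {suc (suc n)} (λ i → F (toℕ i) * (F ⊛^ n) (suc n ∸ toℕ i)) (suc zero) λ where
      zero          _   → trans (*-congʳ F₀≈0) (zeroˡ _)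
      (suc zero)    1≢1 → contradiction ≡.refl 1≢1
      (suc (suc i)) _   → trans (*-congˡ (⊛^-order F F₀≈0
        (ℕ.∸-monoʳ-< ℕ.z<s (Fin.toℕ<n i)))) (zeroʳ _))
    (*-congˡ (⊛^-leading F F₀≈0 n))

  t-⊛^-off-diagonal : ∀ {k n} → k < n → (t ⊛^ k) n ≈ 0#
  t-⊛^-off-diagonal {zero}  {suc n} _     = refl
  t-⊛^-off-diagonal {suc k} {suc n} (s<s k<n) =
   sum-zero {suc (suc n)} (λ i → t (toℕ i) * (t ⊛^ k) (suc n ∸ toℕ i)) λ where
    zero          → zeroˡ _
    (suc zero)    → trans (*-congˡ (t-⊛^-off-diagonal k<n)) (zeroʳ _)
    (suc (suc i)) → zeroˡ _

  -- The sum stops at `k = n`, and the powers of `t` with `k < n` have no term of degree `n`. Only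
  -- the diagonal is left, where `⊛^-leading` gives a power of `1#`.
  ⊚-scale-t : ∀ F x n → (F ⊚ (λ i → x * t i)) n ≈ F n * x ^ n
  ⊚-scale-t F x n = trans
    (sum-last {n} (λ k → F k * ((λ i → x * t i) ⊛^ k) n) λ {k} k<n →
      trans (*-congˡ (trans (scale-⊛^ x t k n)
        (trans (*-congˡ (t-⊛^-off-diagonal k<n)) (zeroʳ _)))) (zeroʳ _))
    (*-congˡ (trans (scale-⊛^ x t n n)
      (trans (*-congˡ (trans (⊛^-leading t refl n) (1^n≈1 n))) (*-identityʳ _))))

  ⊚-congʳ : ∀ F {G H} → G ≋ H → F ⊚ G ≋ F ⊚ H
  ⊚-congʳ F G≋H n = sum-cong-≋ {suc n} λ k → *-congˡ {F (toℕ k)} (⊛^-cong G≋H (toℕ k) n)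

  OddCoefficients : Series → Set ℓ
  OddCoefficients F = ∀ n → (- 1#) ^ n * F n ≈ - 1# * F n

  -- Reading `⊝ t` as `t` scaled by `- 1#` makes `⊚-scale-t` applicable to the composite that
  -- defines oddness.
  odd⇒oddCoefficients : ∀ {F} → F ⊚ (⊝ t) ≋ ⊝ F → OddCoefficients F
  odd⇒oddCoefficients {F} F-odd n = begin
    (- 1#) ^ n * F n             ≈⟨ *-comm _ _ ⟩
    F n * (- 1#) ^ n             ≈⟨ ⊚-scale-t F (- 1#) n ⟨
    (F ⊚ (λ i → - 1# * t i)) n   ≈⟨ ⊚-congʳ F (λ i → -1*x≈-x (t i)) n ⟩
    (F ⊚ (⊝ t)) n                ≈⟨ F-odd n ⟩
    - F n                        ≈⟨ -1*x≈-x (F n) ⟨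
    - 1# * F n                   ∎

  -- Both sides come from a power of one series, F(-t) = -F(t): as a twist it yields `(- 1#) ^ n`,
  -- as a scaling `(- 1#) ^ k`.
  odd-⊛^ : ∀ {F} → OddCoefficients F →
           ∀ k n → (- 1#) ^ n * (F ⊛^ k) n ≈ (- 1#) ^ k * (F ⊛^ k) n
  odd-⊛^ {F} F-odd k n = begin
    (- 1#) ^ n * (F ⊛^ k) n              ≈⟨ twist-⊛^ (- 1#) F k n ⟨
    ((λ i → (- 1#) ^ i * F i) ⊛^ k) n    ≈⟨ ⊛^-cong F-odd k n ⟩
    ((λ i → - 1# * F i) ⊛^ k) n          ≈⟨ scale-⊛^ (- 1#) F k n ⟩
    (- 1#) ^ k * (F ⊛^ k) n              ∎

  t-oddCoefficients : OddCoefficients t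
  t-oddCoefficients zero          = trans (zeroʳ _) (sym (zeroʳ _))
  t-oddCoefficients (suc zero)    = *-congʳ (*-identityʳ _)
  t-oddCoefficients (suc (suc n)) = trans (zeroʳ _) (sym (zeroʳ _))

  -- Since F and t = G ∘ F are odd, comparing the coefficients of tⁿ gives
  -- Σₖ ((-1)ᵏ Gₖ + Gₖ) (Fᵏ)ₙ = 0, where the terms with k < n
  -- vanish inductively and (Fⁿ)ₙ = F₁ⁿ.
  inverse-oddCoefficients :
    ∀ {F G} → F 0 ≈ 0# → (∀ {x} n → x * F 1 ^ n ≈ 0# → x ≈ 0#) →
    OddCoefficients F → G ⊚ F ≋ t → OddCoefficients G
  inverse-oddCoefficients {F} {G} F₀≈0 F₁-cancel F-odd G⊚F≋t n =
    trans (+-inverseˡ-unique _ _ (<-rec _ step n)) (sym (-1*x≈-x (G n)))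
    where
    D : ℕ → Carrier
    D k = (- 1#) ^ k * G k + G k

    sum-D : ∀ n → sum {suc n} (λ k → D (toℕ k) * (F ⊛^ toℕ k) n) ≈ 0#
    sum-D n = begin
      sum {suc n} (λ k → D (toℕ k) * (F ⊛^ toℕ k) n)
        ≈⟨ sum-cong-≋ {suc n} (λ k → trans
             (solve 3 (λ s g p → (s :* g :+ g) :* p := g :* (s :* p) :+ g :* p) refl
               ((- 1#) ^ toℕ k) (G (toℕ k)) ((F ⊛^ toℕ k) n))
             (+-congʳ (trans
               (*-congˡ (sym (odd-⊛^ F-odd (toℕ k) n)))
               (solve 3 (λ s g p → g :* (s :* p) := s :* (g :* p)) refl
                 ((- 1#) ^ n) (G (toℕ k)) ((F ⊛^ toℕ k) n))))) ⟩
      sum {suc n} (λ k → (- 1#) ^ n * GF k + GF k)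
        ≈⟨ ∑-distrib-+ {suc n} (λ k → (- 1#) ^ n * GF k) GF ⟩
      sum {suc n} (λ k → (- 1#) ^ n * GF k) + sum GF
        ≈⟨ +-congʳ (*-distribˡ-sum ((- 1#) ^ n) GF) ⟨
      (- 1#) ^ n * sum GF + sum GF
        ≈⟨ +-cong (*-congˡ (G⊚F≋t n)) (G⊚F≋t n) ⟩
      (- 1#) ^ n * t n + t n
        ≈⟨ +-congʳ (trans (t-oddCoefficients n) (-1*x≈-x (t n))) ⟩
      - t n + t n
        ≈⟨ -‿inverseˡ (t n) ⟩
      0# ∎
      where
      GF : Fin (suc n) → Carrier
      GF k = G (toℕ k) * (F ⊛^ toℕ k) n

    step : ∀ n → (∀ {k} → k < n → D k ≈ 0#) → D n ≈ 0#
    step n D≈0 = F₁-cancel n (begin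
      D n * F 1 ^ n          ≈⟨ *-congˡ (⊛^-leading F F₀≈0 n) ⟨
      D n * (F ⊛^ n) n       ≈⟨ sum-last {n} (λ k → D k * (F ⊛^ k) n)
                                  (λ k<n → trans (*-congʳ (D≈0 k<n)) (zeroˡ _)) ⟨
      sum {suc n} (λ k → D (toℕ k) * (F ⊛^ toℕ k) n) ≈⟨ sum-D n ⟩
      0#                     ∎)

-- Falling factorials and their reflection.

module FallingFactorials (R : CommutativeRing c ℓ) where
  open CommutativeRing R hiding (zero)
  open SetoidReasoning setoid
  open SemiringMult semiring using (_×_; ×-homo-+)
  open Exp commutativeSemiring using (_^_)
  open SemiringSolver commutativeSemiring using (solve; _:*_; _:=_)
  open RingProperties ring
    using (-0#≈0#; -‿+-comm; -1*x≈-x; -‿involutive; xyx⁻¹≈y; x≈z//y)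
  open MonoidSum *-monoid using ()
    renaming (sum to product; sum-cong-≋ to product-cong; sum-init-last to product-init-last)

  ι : ℕ → Carrier
  ι n = n × 1#

  ι-∸ : ∀ {m n} → m ≤ n → ι (n ∸ m) ≈ ι n - ι m
  ι-∸ {m} {n} m≤n = x≈z//y _ _ _ (trans
    (sym (×-homo-+ 1# (n ∸ m) m)) (reflexive (≡.cong ι (ℕ.m∸n+n≡m m≤n))))

  ff : Carrier → ℕ → Carrier
  ff y n = product {n} λ i → y - ι (toℕ i)

  ff-cong : ∀ n {y z} → y ≈ z → ff y n ≈ ff z n
  ff-cong n y≈z = product-cong {n} λ i → +-congʳ y≈z

  ff-first : ∀ y n → ff y (suc n) ≈ y * ff (y - 1#) n
  ff-first y n = *-cong
    (trans (+-congˡ -0#≈0#) (+-identityʳ y))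
    (product-cong {n} λ i → trans
      (+-congˡ (sym (-‿+-comm 1# (ι (toℕ i)))))
      (sym (+-assoc y (- 1#) _)))

  ff-last : ∀ y n → ff y (suc n) ≈ ff y n * (y - ι n)
  ff-last y n = trans
    (product-init-last {n} λ i → y - ι (toℕ i))
    (*-cong
      (product-cong {n} λ i → reflexive (≡.cong (λ k → y - ι k) (Fin.toℕ-inject₁ i)))
      (reflexive (≡.cong (λ k → y - ι k) (Fin.toℕ-fromℕ n))))

  -- The factors of `ff z n` are, in reverse order, the negatives of those of `ff y n`. So the
  -- induction peels the first factor from one product and the last from the other.
  ff-reflect : ∀ n y z → y + z + 1# ≈ ι n → ff z n ≈ (- 1#) ^ n * ff y n
  ff-reflect zero    y z _       = sym (*-identityʳ 1#)
  ff-reflect (suc n) y z y+z+1≈n = begin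
    ff z (suc n)
      ≈⟨ ff-first z n ⟩
    z * ff (z - 1#) n
      ≈⟨ *-cong (sym (-‿involutive z)) (ff-reflect n y (z - 1#)
           (trans (+-congʳ (sym (+-assoc y z _))) (trans (cancel (y + z)) y+z≈n))) ⟩
    - - z * ((- 1#) ^ n * ff y n)
      -- One sign of the double negation joins `(- 1#) ^ n`. The other stays on `z`, since `- z` is
      -- the last factor `y - ι n` of `ff y (suc n)`.
      ≈⟨ *-congʳ (sym (-1*x≈-x (- z))) ⟩
    - 1# * - z * ((- 1#) ^ n * ff y n)
      ≈⟨ solve 4 (λ m z s p → m :* z :* (s :* p) := m :* s :* (p :* z)) refl
           (- 1#) (- z) ((- 1#) ^ n) (ff y n) ⟩
    (- 1#) ^ suc n * (ff y n * - z)
      ≈⟨ *-congˡ (*-congˡ -z≈y-n) ⟩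
    (- 1#) ^ suc n * (ff y n * (y - ι n))
      ≈⟨ *-congˡ (ff-last y n) ⟨
    (- 1#) ^ suc n * ff y (suc n) ∎
    where
    cancel : ∀ x → x - 1# + 1# ≈ x
    cancel x = trans (+-assoc x _ _) (trans (+-congˡ (-‿inverseˡ 1#)) (+-identityʳ x))

    y+z≈n : y + z ≈ ι n
    y+z≈n = begin
      y + z         ≈⟨ x≈z//y _ _ _ y+z+1≈n ⟩
      1# + ι n - 1# ≈⟨ xyx⁻¹≈y 1# (ι n) ⟩
      ι n           ∎

    -z≈y-n : - z ≈ y - ι n
    -z≈y-n = sym (begin
      y - ι n       ≈⟨ +-congˡ (-‿cong y+z≈n) ⟨
      y - (y + z)   ≈⟨ +-congˡ (-‿+-comm y z) ⟨
      y + (- y - z) ≈⟨ +-assoc y (- y) (- z) ⟨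
      y - y - z     ≈⟨ +-congʳ (-‿inverseʳ y) ⟩
      0# - z        ≈⟨ +-identityˡ (- z) ⟩
      - z           ∎)

  -- One factor is `ι m - ι m`; lowering both arguments until the base is `0#` brings it to the
  -- front.
  ff-vanish : ∀ {m n} → m < n → ff (ι m) n ≈ 0#
  ff-vanish {zero}  {suc n} _         = trans (ff-first 0# n) (zeroˡ _)
  ff-vanish {suc m} {suc n} (s<s m<n) = begin
    ff (ι (suc m)) (suc n)            ≈⟨ ff-first _ n ⟩
    ι (suc m) * ff (1# + ι m - 1#) n  ≈⟨ *-congˡ (ff-cong n (xyx⁻¹≈y 1# (ι m))) ⟩
    ι (suc m) * ff (ι m) n            ≈⟨ *-congˡ (ff-vanish m<n) ⟩
    ι (suc m) * 0#                    ≈⟨ zeroʳ _ ⟩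
    0#                                ∎

-- Binomial coefficients over a field of characteristic zero.

module Parity (K : HeytingField c ℓ₁ ℓ₂) (char0 : CharacteristicZero K) where
  open HeytingField K using (#⇒invertible; heytingCommutativeRing)

  R : CommutativeRing _ _
  R = HeytingCommutativeRing.commutativeRing heytingCommutativeRing

  open CommutativeRing R hiding (zero)
  open SetoidReasoning setoid
  open SemiringSolver commutativeSemiring using (solve; _:+_; _:*_; _:=_)
  open RingProperties ring
    using (-0#≈0#; -1*x≈-x; -‿involutive; xyx⁻¹≈y; x∙y⁻¹≈ε⇒x≈y)
  open SemiringSum semiring
  open Exp commutativeSemiring using (_^_; ^-distrib-*; ^-congˡ)
  open RingSums R
  open SeriesPowers R
    using (_⊛^_; ⊛^-cong; scale-⊛^; OddCoefficients; odd-⊛^; odd⇒oddCoefficients; inverse-oddCoefficients)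
  open FallingFactorials R
  open Evaluation R
  open Umbral K char0

  unit-cancel : ∀ {u v x y} → u * v ≈ 1# → x * u ≈ y * u → x ≈ y
  unit-cancel {u} {v} {x} {y} uv≈1 xu≈yu = begin
    x           ≈⟨ *-identityʳ x ⟨
    x * 1#      ≈⟨ *-congˡ uv≈1 ⟨
    x * (u * v) ≈⟨ *-assoc x u v ⟨
    x * u * v   ≈⟨ *-congʳ xu≈yu ⟩
    y * u * v   ≈⟨ *-assoc y u v ⟩
    y * (u * v) ≈⟨ *-congˡ uv≈1 ⟩
    y * 1#      ≈⟨ *-identityʳ y ⟩
    y           ∎

  1/[1+_] : ℕ → Carrier
  1/[1+ n ] = proj₁ (#⇒invertible (char0 n))

  1/[1+n]-inverseˡ : ∀ n → 1/[1+ n ] * ι (suc n) ≈ 1#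
  1/[1+n]-inverseˡ n = trans
    -- Apartness from `0#` inverts the difference `ι (suc n) - 0#`; the subtracted zero is removed
    -- here.
    (*-congˡ (sym (trans (+-congˡ -0#≈0#) (+-identityʳ _))))
    (proj₁ (proj₂ (#⇒invertible (char0 n))))

  -- `1/ n !` is a product of inverses; cancelling them one at a time avoids introducing the
  -- factorial itself.
  1/!-cancel : ∀ n {x y} → x * 1/ n ! ≈ y * 1/ n ! → x ≈ y
  1/!-cancel zero    = unit-cancel (*-identityˡ 1#)
  1/!-cancel (suc n) xw≈yw = unit-cancel (1/[1+n]-inverseˡ n)
    (1/!-cancel n (trans (*-assoc _ _ _) (trans xw≈yw (sym (*-assoc _ _ _)))))

  binom : ℕ → Carrier → Carrier
  binom n y = ff y n * 1/ n !

  binom-cong : ∀ n {y z} → y ≈ z → binom n y ≈ binom n z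
  binom-cong n y≈z = *-congʳ (ff-cong n y≈z)

  binom-reflect : ∀ n y z → y + z + 1# ≈ ι n → binom n z ≈ (- 1#) ^ n * binom n y
  binom-reflect n y z y+z+1≈n = trans (*-congʳ (ff-reflect n y z y+z+1≈n)) (*-assoc _ _ _)

  binom-vanish : ∀ {m n} → m < n → binom n (ι m) ≈ 0#
  binom-vanish m<n = trans (*-congʳ (ff-vanish m<n)) (zeroˡ _)

  -- The first factor `ι (suc n)` of the numerator meets `1/[1+ n ]`, leaving the case `n`.
  binom-diagonal : ∀ n → binom n (ι n) ≈ 1#
  binom-diagonal zero    = *-identityˡ 1#
  binom-diagonal (suc n) = begin
    ff (ι (suc n)) (suc n) * (1/[1+ n ] * 1/ n !)
      ≈⟨ *-congʳ (trans (ff-first _ n) (*-congˡ (ff-cong n (xyx⁻¹≈y 1# (ι n))))) ⟩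
    ι (suc n) * ff (ι n) n * (1/[1+ n ] * 1/ n !)
      ≈⟨ solve 4 (λ i p u w → i :* p :* (u :* w) := u :* i :* (p :* w)) refl
           (ι (suc n)) (ff (ι n) n) 1/[1+ n ] (1/ n !) ⟩
    1/[1+ n ] * ι (suc n) * binom n (ι n)
      ≈⟨ *-cong (1/[1+n]-inverseˡ n) (binom-diagonal n) ⟩
    1# * 1#
      ≈⟨ *-identityˡ 1# ⟩
    1# ∎

  -- Values of the Eulerian expansion and of the generating function.

  module _ (a : Carrier) where
    open IsRingHomomorphism (eval-isRingHomomorphism a)
      using (+-homo; *-homo; -‿homo; 1#-homo; +-isMonoidHomomorphism; *-isMonoidHomomorphism)
    open MonoidHomomorphism +-monoid +-isMonoidHomomorphism using (sum-homo; ×-homo)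
    open MonoidHomomorphism *-monoid *-isMonoidHomomorphism using ()
      renaming (sum-homo to product-homo)
    open SeriesHomomorphism R (eval-isRingHomomorphism a) using (^-homo)
    open SemiringMult semiring using (×-congʳ)
    open MonoidSum *-monoid using () renaming (sum-cong-≋ to product-cong)
    open RawSemiringDefs K[x].rawSemiring using (_×_; product)
      renaming (sum to sumˣ)
    open RawSemiringDefs K[x][[t]].rawSemiring using () renaming (_^_ to _⊛ˣ^_)

    eval-ι : ∀ n → eval a (n × K[x].1#) ≈ ι n
    eval-ι n = trans (×-homo n _) (×-congʳ n 1#-homo)

    eval--ₓ : ∀ p q → eval a (p -ₓ q) ≈ eval a p - eval a q
    eval--ₓ p q = trans (+-homo p _) (+-congˡ (-‿homo q))

    eval-binomial : ∀ y n → eval a (binomial y n) ≈ binom n (eval a y)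
    eval-binomial y n = trans (*-homo (product {n} λ i → y -ₓ toℕ i × K[x].1#) (const (1/ n !))) (*-cong
      (trans (product-homo {n} λ i → y -ₓ toℕ i × K[x].1#)
        (product-cong {n} λ i → trans (eval--ₓ y (toℕ i × K[x].1#)) (+-congˡ (-‿cong (eval-ι (toℕ i))))))
      (eval-const a _))

    eval-eulerian : ∀ p A → IsEulerian p A → ∀ n → eval a (p n) ≈
      sum {suc n} λ k → A n (toℕ k) * binom n (a + ι n - ι (toℕ k) - 1#)
    eval-eulerian p A eulerian n = trans (eval-cong a (p n) (sumˣ term) (eulerian n)) (trans
      (sum-homo term)
      (sum-cong-≋ {suc n} λ k → trans (*-homo (const (A n (toℕ k))) (binomial (y k) n))
        (*-cong (eval-const a _) (trans (eval-binomial (y k) n) (binom-cong n (eval-y k))))))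
      where
      y : Fin (suc n) → Poly
      y k = X K[x].+ n × K[x].1# -ₓ toℕ k × K[x].1# -ₓ K[x].1#

      term : Fin (suc n) → Poly
      term k = const (A n (toℕ k)) K[x].* binomial (y k) n

      eval-y : ∀ k → eval a (y k) ≈ a + ι n - ι (toℕ k) - 1#
      eval-y k = trans (eval--ₓ (X K[x].+ n × K[x].1# -ₓ toℕ k × K[x].1#) K[x].1#) (+-cong
        (trans (eval--ₓ (X K[x].+ n × K[x].1#) (toℕ k × K[x].1#)) (+-cong
          (trans (+-homo X (n × K[x].1#)) (+-cong (eval-X a) (eval-ι n)))
          (-‿cong (eval-ι (toℕ k)))))
        (-‿cong 1#-homo))

    -- This is the coefficient of tⁿ in e^(a f̄(t)), with the powers of `a` pulled out so that signs
    -- in `a` can be traded against signs in `f̄`.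
    eval-sheffer : ∀ {f p} (sheffer : IsSheffer[1, f ] p) →
      let open IsSheffer[1,_] sheffer using (f̄) in
      ∀ n → eval a (p n) * 1/ n ! ≈ sum {suc n} λ k → 1/ toℕ k ! * (a ^ toℕ k * (f̄ ⊛^ toℕ k) n)
    eval-sheffer {f} {p} sheffer n = begin
      eval a (p n) * 1/ n !
        ≈⟨ *-congˡ (eval-const a _) ⟨
      eval a (p n) * eval a (const (1/ n !))
        ≈⟨ *-homo (p n) _ ⟨
      eval a (p n K[x].* const (1/ n !))
        ≈⟨ eval-cong a (p n K[x].* const (1/ n !)) ((exp K[x][t].⊚ (x· f̄)) n) (Σpₙtⁿ/n!≈eˣᶠ̄ n) ⟩
      eval a ((exp K[x][t].⊚ (x· f̄)) n)
        ≈⟨ sum-homo {suc n} (λ k → exp (toℕ k) K[x].* ((x· f̄) ⊛ˣ^ toℕ k) n) ⟩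
      sum {suc n} (λ k → eval a (exp (toℕ k) K[x].* ((x· f̄) ⊛ˣ^ toℕ k) n))
        ≈⟨ sum-cong-≋ {suc n} (λ k → trans (*-homo (exp (toℕ k)) (((x· f̄) ⊛ˣ^ toℕ k) n))
             (*-cong (eval-const a _)
             (trans (^-homo (x· f̄) (toℕ k) n)
               (trans (⊛^-cong eval-x· (toℕ k) n) (scale-⊛^ a f̄ (toℕ k) n))))) ⟩
      sum {suc n} (λ k → 1/ toℕ k ! * (a ^ toℕ k * (f̄ ⊛^ toℕ k) n)) ∎
      where
      open IsSheffer[1,_] sheffer
      eval-x· : ∀ i → eval a ((x· f̄) i) ≈ a * f̄ i
      eval-x· i = trans (*-homo X (const (f̄ i))) (*-cong (eval-X a) (eval-const a _))

  -- Parity of the Sheffer polynomials.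

  module _ {f p} (f-delta : IsDelta f) (f-odd : Odd f) (sheffer : IsSheffer[1, f ] p) where
    open IsDelta f-delta
    open IsSheffer[1,_] sheffer
    open IsCompositionalInverse f̄-inverse

    -- Supplies the cancellation that `inverse-oddCoefficients` asks for: `f′[0]#0` makes `f 1`
    -- invertible, and its power is removed factor by factor.
    f₁-cancel : ∀ {x} n → x * f 1 ^ n ≈ 0# → x ≈ 0#
    f₁-cancel zero    x1≈0 = trans (sym (*-identityʳ _)) x1≈0
    f₁-cancel (suc n) xf≈0 = unit-cancel f₁-inverse
      (trans (f₁-cancel n (trans (*-assoc _ _ _) xf≈0)) (sym (zeroˡ _)))
      where
      f₁-inverse : f 1 * proj₁ (#⇒invertible f′[0]#0) ≈ 1#
      f₁-inverse = trans
        (*-congʳ (sym (trans (+-congˡ -0#≈0#) (+-identityʳ _))))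
        (proj₂ (proj₂ (#⇒invertible f′[0]#0)))

    f̄-oddCoefficients : OddCoefficients f̄
    -- Here `f` is the inner series and `f̄` the outer one, so the relation wanted is `f̄∘f≈t`.
    f̄-oddCoefficients = inverse-oddCoefficients f[0]≈0 f₁-cancel
      (odd⇒oddCoefficients f-odd) f̄∘f≈t

    -- In the term `k`, `(- a) ^ k` contributes `(- 1#) ^ k`, which `odd-⊛^` exchanges for
    -- `(- 1#) ^ n`. That sign is independent of `k` and leaves the sum.
    sheffer-parity : ∀ n a → eval (- a) (p n) ≈ (- 1#) ^ n * eval a (p n)
    sheffer-parity n a = 1/!-cancel n (begin
      eval (- a) (p n) * 1/ n !
        ≈⟨ eval-sheffer (- a) sheffer n ⟩
      sum {suc n} (λ k → 1/ toℕ k ! * ((- a) ^ toℕ k * (f̄ ⊛^ toℕ k) n))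
        ≈⟨ sum-cong-≋ {suc n} (λ k → step (toℕ k)) ⟩
      sum {suc n} (λ k → (- 1#) ^ n * (1/ toℕ k ! * (a ^ toℕ k * (f̄ ⊛^ toℕ k) n)))
        ≈⟨ *-distribˡ-sum {suc n} ((- 1#) ^ n) (λ k → 1/ toℕ k ! * (a ^ toℕ k * (f̄ ⊛^ toℕ k) n)) ⟨
      (- 1#) ^ n * sum {suc n} (λ k → 1/ toℕ k ! * (a ^ toℕ k * (f̄ ⊛^ toℕ k) n))
        ≈⟨ *-congˡ (eval-sheffer a sheffer n) ⟨
      (- 1#) ^ n * (eval a (p n) * 1/ n !)
        ≈⟨ *-assoc _ _ _ ⟨
      (- 1#) ^ n * eval a (p n) * 1/ n ! ∎)
      where
      step : ∀ k → 1/ k ! * ((- a) ^ k * (f̄ ⊛^ k) n) ≈ (- 1#) ^ n * (1/ k ! * (a ^ k * (f̄ ⊛^ k) n))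
      step k = begin
        1/ k ! * ((- a) ^ k * (f̄ ⊛^ k) n)
          ≈⟨ *-congˡ (*-congʳ (trans (^-congˡ k (sym (-1*x≈-x a))) (^-distrib-* (- 1#) a k))) ⟩
        1/ k ! * ((- 1#) ^ k * a ^ k * (f̄ ⊛^ k) n)
          ≈⟨ solve 4 (λ w s x g → w :* (s :* x :* g) := w :* x :* (s :* g)) refl
               (1/ k !) ((- 1#) ^ k) (a ^ k) ((f̄ ⊛^ k) n) ⟩
        1/ k ! * a ^ k * ((- 1#) ^ k * (f̄ ⊛^ k) n)
          ≈⟨ *-congˡ (odd-⊛^ f̄-oddCoefficients k n) ⟨
        1/ k ! * a ^ k * ((- 1#) ^ n * (f̄ ⊛^ k) n)
          ≈⟨ solve 4 (λ w s x g → w :* x :* (s :* g) := s :* (w :* (x :* g))) refl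
               (1/ k !) ((- 1#) ^ n) (a ^ k) ((f̄ ⊛^ k) n) ⟩
        (- 1#) ^ n * (1/ k ! * (a ^ k * (f̄ ⊛^ k) n)) ∎

  -- At x = 0 the exponential collapses to 1: in positive degree the term `k = 0` dies in `f̄ ⊛^ 0`,
  -- the others in `0# ^ k`.
  sheffer-eval-0 : ∀ {f p} → IsSheffer[1, f ] p → ∀ n → eval 0# (p (suc n)) ≈ 0#
  sheffer-eval-0 sheffer n = 1/!-cancel (suc n) (trans
    (eval-sheffer 0# sheffer (suc n))
    (trans
      (sum-zero {suc (suc n)} (λ k → 1/ toℕ k ! * (0# ^ toℕ k * (f̄ ⊛^ toℕ k) (suc n))) λ where
        zero    → trans (*-congˡ (zeroʳ _)) (zeroʳ _)
        (suc k) → trans (*-congˡ (trans (*-congʳ (zeroˡ _)) (zeroˡ _))) (zeroʳ _))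
      (sym (zeroˡ _))))
    where open IsSheffer[1,_] sheffer

  -- At y = m + n the terms j > m vanish and the term j = m is D m.
  binomials-independent : ∀ n (D : ℕ → Carrier) →
    (∀ y → sum {n} (λ j → D (toℕ j) * binom n (y - ι (toℕ j))) ≈ 0#) →
    ∀ {m} → m < n → D m ≈ 0#
  binomials-independent n D sum≈0 {m} = <-rec (λ m → m < n → D m ≈ 0#) step m
    where
    step : ∀ m → (∀ {j} → j < m → j < n → D j ≈ 0#) → m < n → D m ≈ 0#
    step m D≈0 m<n = begin
      D m
        ≈⟨ *-identityʳ (D m) ⟨
      D m * 1#
        ≈⟨ *-congˡ (trans (binom-cong n (shift m<n))
             (trans (reflexive (≡.cong (binom n ∘ ι) (ℕ.m+n∸m≡n m n))) (binom-diagonal n))) ⟨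
      term m
        ≈⟨ reflexive (≡.cong term (Fin.toℕ-fromℕ< m<n)) ⟨
      term (toℕ (fromℕ< m<n))
        ≈⟨ sum-single {n} (term ∘ toℕ) (fromℕ< m<n) (λ j j≢m → vanish j λ j≡m →
             j≢m (Fin.toℕ-injective (≡.trans j≡m (≡.sym (Fin.toℕ-fromℕ< m<n))))) ⟨
      sum {n} (term ∘ toℕ)
        ≈⟨ sum≈0 y ⟩
      0# ∎
      where
      y = ι (m ℕ.+ n)

      term : ℕ → Carrier
      term j = D j * binom n (y - ι j)

      shift : ∀ {j} → j < n → y - ι j ≈ ι (m ℕ.+ n ∸ j)
      shift j<n = sym (ι-∸ (ℕ.≤-trans (ℕ.<⇒≤ j<n) (ℕ.m≤n+m n m)))

      vanish : ∀ (j : Fin n) → toℕ j ≢ m → term (toℕ j) ≈ 0#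
      vanish j j≢m with ℕ.<-cmp (toℕ j) m
      ... | tri< j<m _ _ = trans (*-congʳ (D≈0 j<m (Fin.toℕ<n j))) (zeroˡ _)
      ... | tri≈ _ j≡m _ = contradiction j≡m j≢m
      ... | tri> _ _ m<j = trans (*-congˡ (trans (binom-cong n (shift (Fin.toℕ<n j)))
        (binom-vanish (ℕ.m<n+o⇒m∸n<o _ _ {{ℕ.>-nonZero (ℕ.≤-<-trans z≤n m<n)}} (ℕ.+-monoˡ-< n m<j))))) (zeroʳ _)

  -- Symmetry of the Eulerian numbers.

  module _ {f p} (A : ℕ → ℕ → Carrier) (f-delta : IsDelta f) (f-odd : Odd f)
           (sheffer : IsSheffer[1, f ] p) (eulerian : IsEulerian p A) where

    -- A second expansion of the same value: the Eulerian expansion is taken at `- a`, and the sign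
    -- from parity is exactly the one that `binom-reflect` absorbs.
    eval-reflected-eulerian : ∀ n a → eval a (p n) ≈
      sum {suc n} λ k → A n (toℕ k) * binom n (a + ι (toℕ k))
    eval-reflected-eulerian n a = begin
      eval a (p n)
        ≈⟨ eval-congˡ (p n) (-‿involutive a) ⟨
      eval (- - a) (p n)
        ≈⟨ sheffer-parity f-delta f-odd sheffer n (- a) ⟩
      (- 1#) ^ n * eval (- a) (p n)
        ≈⟨ *-congˡ (eval-eulerian (- a) p A eulerian n) ⟩
      (- 1#) ^ n * sum {suc n} (λ k → A n (toℕ k) * binom n (z (toℕ k)))
        ≈⟨ *-distribˡ-sum {suc n} ((- 1#) ^ n) (λ k → A n (toℕ k) * binom n (z (toℕ k))) ⟩
      sum {suc n} (λ k → (- 1#) ^ n * (A n (toℕ k) * binom n (z (toℕ k))))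
        ≈⟨ sum-cong-≋ {suc n} (λ k → trans
             (solve 3 (λ s x b → s :* (x :* b) := x :* (s :* b)) refl
               ((- 1#) ^ n) (A n (toℕ k)) (binom n (z (toℕ k))))
             (*-congˡ (sym (binom-reflect n (z (toℕ k)) (a + ι (toℕ k)) (reflected (toℕ k)))))) ⟩
      sum {suc n} (λ k → A n (toℕ k) * binom n (a + ι (toℕ k))) ∎
      where
      z : ℕ → Carrier
      z k = - a + ι n - ι k - 1#

      reflected : ∀ k → z k + (a + ι k) + 1# ≈ ι n
      reflected k = begin
        - a + ι n - ι k - 1# + (a + ι k) + 1#
          -- The solver knows only semiring laws, so negated terms enter as separate variables and
          -- cancel in the next step.
          ≈⟨ solve 7 (λ a⁻ n k⁻ u⁻ a k u → a⁻ :+ n :+ k⁻ :+ u⁻ :+ (a :+ k) :+ u :=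
               n :+ (a⁻ :+ a) :+ (k⁻ :+ k) :+ (u⁻ :+ u)) refl
               (- a) (ι n) (- ι k) (- 1#) a (ι k) 1# ⟩
        ι n + (- a + a) + (- ι k + ι k) + (- 1# + 1#)
          ≈⟨ +-cong (+-cong (+-congˡ (-‿inverseˡ a)) (-‿inverseˡ (ι k))) (-‿inverseˡ 1#) ⟩
        ι n + 0# + 0# + 0#
          ≈⟨ trans (+-identityʳ _) (trans (+-identityʳ _) (+-identityʳ _)) ⟩
        ι n ∎

    -- At `a = 0#` the reflected binomials are C(k, n), which vanish for `k < n` and equal `1#` at
    -- `k = n`. So the value at 0 is the top coefficient.
    eulerian-last : ∀ n → A (suc n) (suc n) ≈ 0#
    eulerian-last N = begin
      A n n
        ≈⟨ *-identityʳ (A n n) ⟨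
      A n n * 1#
        ≈⟨ *-congˡ (trans (binom-cong n (+-identityˡ (ι n))) (binom-diagonal n)) ⟨
      A n n * binom n (0# + ι n)
        ≈⟨ sum-last {n} (λ k → A n k * binom n (0# + ι k)) (λ {k} k<n → trans
             (*-congˡ (trans (binom-cong n (+-identityˡ (ι k))) (binom-vanish k<n))) (zeroʳ _)) ⟨
      sum {suc n} (λ k → A n (toℕ k) * binom n (0# + ι (toℕ k)))
        ≈⟨ eval-reflected-eulerian n 0# ⟨
      eval 0# (p n)
        ≈⟨ sheffer-eval-0 sheffer N ⟩
      0# ∎
      where n = suc N

    -- With the top coefficient gone, both expansions run over the same binomials
    -- `binom n (y - ι k)` with `k < n`, and independence applies to the difference `D` of their
    -- coefficients.
    eulerian-symmetric : ∀ N {k} → k < suc N → A (suc N) k ≈ A (suc N) (N ∸ k)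
    eulerian-symmetric N k<n = x∙y⁻¹≈ε⇒x≈y _ _ (trans
      (+-congˡ (sym (-1*x≈-x _))) (binomials-independent n D sum-D k<n))
      where
      n = suc N

      D : ℕ → Carrier
      D k = A n k + - 1# * A n (N ∸ k)

      drop-last : ∀ (y : ℕ → Carrier) →
        sum {suc n} (λ k → A n (toℕ k) * binom n (y (toℕ k))) ≈
        sum {n} (λ k → A n (toℕ k) * binom n (y (toℕ k)))
      drop-last y = trans (sum-snoc n (λ k → A n k * binom n (y k)))
        (trans (+-congˡ (trans (*-congʳ (eulerian-last N)) (zeroˡ _))) (+-identityʳ _))

      module _ (y : Carrier) where
        -- This shift turns the arguments `x + ι n - ι k - 1#` into `y - ι k`, the shape that
        -- `binomials-independent` expects.
        x = y - ι N

        forward : eval x (p n) ≈ sum {n} λ k → A n (toℕ k) * binom n (y - ι (toℕ k))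
        forward = trans (eval-eulerian x p A eulerian n) (trans
          (drop-last λ k → x + ι n - ι k - 1#)
          (sum-cong-≋ {n} λ k → *-congˡ {A n (toℕ k)} (binom-cong n (shift (toℕ k)))))
          where
          shift : ∀ k → x + ι n - ι k - 1# ≈ y - ι k
          shift k = begin
            y - ι N + (1# + ι N) - ι k - 1#
              ≈⟨ solve 6 (λ y N⁻ N u k⁻ u⁻ → y :+ N⁻ :+ (u :+ N) :+ k⁻ :+ u⁻ :=
                   y :+ k⁻ :+ (N⁻ :+ N) :+ (u⁻ :+ u)) refl y (- ι N) (ι N) 1# (- ι k) (- 1#) ⟩
            y - ι k + (- ι N + ι N) + (- 1# + 1#)
              ≈⟨ +-cong (+-congˡ (-‿inverseˡ (ι N))) (-‿inverseˡ 1#) ⟩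
            y - ι k + 0# + 0#
              ≈⟨ trans (+-identityʳ _) (+-identityʳ _) ⟩
            y - ι k ∎

        backward : eval x (p n) ≈ sum {n} λ k → A n (N ∸ toℕ k) * binom n (y - ι (toℕ k))
        backward = trans (eval-reflected-eulerian n x) (trans
          -- Dropping the top term first leaves the indices `0` to `N`, on which reversal is
          -- `N ∸ k`.
          (drop-last λ k → x + ι k)
          (trans
            (sum-permute {n} (λ k → A n (toℕ k) * binom n (x + ι (toℕ k))) reverse)
            (sum-cong-≋ {n} λ k → trans
              (reflexive (≡.cong (λ j → A n j * binom n (x + ι j)) (Fin.opposite-prop k)))
              (*-congˡ (binom-cong n (shift (Fin.toℕ≤pred[n] k)))))))
          where
          shift : ∀ {k} → k ≤ N → x + ι (N ∸ k) ≈ y - ι k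
          shift {k} k≤N = begin
            y - ι N + ι (N ∸ k)       ≈⟨ +-congˡ (ι-∸ k≤N) ⟩
            y - ι N + (ι N - ι k)     ≈⟨ solve 4 (λ y N⁻ N k⁻ → y :+ N⁻ :+ (N :+ k⁻) := y :+ k⁻ :+ (N⁻ :+ N))
                                           refl y (- ι N) (ι N) (- ι k) ⟩
            y - ι k + (- ι N + ι N)   ≈⟨ +-congˡ (-‿inverseˡ (ι N)) ⟩
            y - ι k + 0#              ≈⟨ +-identityʳ _ ⟩
            y - ι k                   ∎

        sum-D : sum {n} (λ k → D (toℕ k) * binom n (y - ι (toℕ k))) ≈ 0#
        sum-D = begin
          sum {n} (λ k → D (toℕ k) * binom n (y - ι (toℕ k)))
            ≈⟨ sum-cong-≋ {n} (λ k → solve 4 (λ m u v b → (u :+ m :* v) :* b := u :* b :+ m :* (v :* b)) refl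
                 (- 1#) (A n (toℕ k)) (A n (N ∸ toℕ k)) (binom n (y - ι (toℕ k)))) ⟩
          sum {n} (λ k → S k + - 1# * T k)   ≈⟨ ∑-distrib-+ {n} S (λ k → - 1# * T k) ⟩
          sum S + sum {n} (λ k → - 1# * T k) ≈⟨ +-congˡ (*-distribˡ-sum {n} (- 1#) T) ⟨
          sum S + - 1# * sum T               ≈⟨ +-cong forward (*-congˡ backward) ⟨
          eval x (p n) + - 1# * eval x (p n) ≈⟨ +-congˡ (-1*x≈-x _) ⟩
          eval x (p n) - eval x (p n)        ≈⟨ -‿inverseʳ _ ⟩
          0#                                 ∎
          where
          S T : Fin n → Carrier
          S k = A n (toℕ k) * binom n (y - ι (toℕ k))
          T k = A n (N ∸ toℕ k) * binom n (y - ι (toℕ k))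

theorem3p3 : ∀ {c ℓ₁ ℓ₂ : Level} (K : HeytingField c ℓ₁ ℓ₂) (char0 : CharacteristicZero K) →
    let open HeytingField K in
    let open Umbral K char0 in
    (f : Series) → IsDelta f → Odd f →
    (p : ℕ → Poly) → IsSheffer[1, f ] p →
    (A : ℕ → ℕ → Carrier) → IsEulerian p A →
    (n k : ℕ) → 1 ≤ n → k ≤ n ∸ 1 →
    A n k ≈ A n (n ∸ 1 ∸ k)
theorem3p3 K char0 f f-delta f-odd p sheffer A eulerian (suc N) k _ k≤N =
  eulerian-symmetric A f-delta f-odd sheffer eulerian N (s≤s k≤N)
  where open Parity K char0
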